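{- Let $n\ge 3$ and let $C_n$ be the cycle of length $n$. Then for all positive integers $a,b$ with $\frac{a}{b}\ge 2+\lfloor n/2\rfloor^{ -1}$, the cycle $C_n$ is $(a,b)$-free-choosable. Moreover, the free-choice ratio of $C_n$ satisfies $$\mathrm{fchr}(C_n)=2+\Big\lfloor \frac{n}{2}\Big\rfloor^{ -1}.$$
   Context: For a graph $G$, a list $L$ assigns to each vertex $v$ a finite set $L(v)\subseteq\mathbb{N}$. An $(L,b)$-coloring is a map $c$ with $c(v)\subseteq L(v)$, $|c(v)|=b$ for each vertex, and $c(v)\cap c(v')=\emptyset$ for each edge $vv'$. $G$ is $(a,b)$-free-choosable if for every vertex $v_0\in V(G)$ and every list $L$ with $|L(v)|=a$ for all $v\ne v_0$ and $|L(v_0)|=b$, there exists an $(L,b)$-coloring of $G$. The free-choice ratio is $\mathrm{fchr}(G)=\inf\{a/b : G \text{ is } (a,b)\text{ -free-choosable}\}$. $\lfloor x\rfloor$ is the greatest integer $\le x$. -}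

module Defs where

open import Data.Nat as ℕ using (ℕ; zero; suc; NonZero; _≤_; s≤s; z≤n; >-nonZero)
open import Data.Nat.Properties using (≤-trans)
open import Data.Nat.DivMod using (_/_; m≥n⇒m/n>0; _%_)
open import Data.Integer using (+_)
open import Data.Fin using (Fin; toℕ)
open import Data.List using (List; length)
open import Data.List.Relation.Unary.Unique.Propositional using (Unique)
open import Data.List.Relation.Binary.Subset.Propositional using (_⊆_)
open import Data.List.Relation.Binary.Disjoint.Propositional using (Disjoint)
open import Data.Rational as ℚ using (ℚ)
open import Data.Product using (Σ; _×_; ∃)
open import Data.Sum using (_⊎_)
open import Relation.Binary.PropositionalEquality using (_≡_; _≢_)

record Graph : Set₁ where
  field
    V   : ℕ
    Adj : Fin V → Fin V → Set

open Graph public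

Cycle : (n : ℕ) → .{{NonZero n}} → Graph
Cycle n = record
  { V   = n
  ; Adj = λ i j → (toℕ j ≡ suc (toℕ i) % n) ⊎ (toℕ i ≡ suc (toℕ j) % n) }

-- A finite set of natural numbers of size k, represented as a duplicate-free list.
-- (L,b)-coloring: c(v) ⊆ L(v), |c(v)| = b, adjacent vertices get disjoint sets.
IsColoring : (G : Graph) → (Fin (V G) → List ℕ) → ℕ → (Fin (V G) → List ℕ) → Set
IsColoring G L b c =
  (∀ v → Unique (c v) × length (c v) ≡ b × c v ⊆ L v)
  × (∀ v v′ → Adj G v v′ → Disjoint (c v) (c v′))

FreeChoosable : Graph → ℕ → ℕ → Set
FreeChoosable G a b =
  ∀ (v₀ : Fin (V G)) (L : Fin (V G) → List ℕ) →
  (∀ v → Unique (L v)) →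
  (∀ v → v ≢ v₀ → length (L v) ≡ a) →
  length (L v₀) ≡ b →
  ∃ λ c → IsColoring G L b c

FreeChoiceRatios : Graph → ℚ → Set
FreeChoiceRatios G q =
  Σ ℕ λ a → Σ ℕ λ b → Σ (NonZero b) λ nz →
    1 ≤ a × FreeChoosable G a b × q ≡ (+ a ℚ./ b) {{nz}}

IsInfimum : (ℚ → Set) → ℚ → Set
IsInfimum S r =
  (∀ q → S q → r ℚ.≤ q) × (∀ l → (∀ q → S q → l ℚ.≤ q) → l ℚ.≤ r)

FChrEq : Graph → ℚ → Set
FChrEq G r = IsInfimum (FreeChoiceRatios G) r

invFloorHalf : (n : ℕ) → 3 ≤ n → ℚ
invFloorHalf n h =
  (+ 1 ℚ./ (n / 2)) {{>-nonZero (m≥n⇒m/n>0 {n} {2} (≤-trans (s≤s (s≤s z≤n)) h))}}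

nonZero3 : (n : ℕ) → 3 ≤ n → NonZero n
nonZero3 (suc n) _ = _

{-# OPTIONS --safe #-}
module Submission where

-- Write a = 2b + e and k = ⌊n/2⌋; then a/b ≥ 2 + 1/k means b ≤ k e.
--
-- Sufficiency.  Cut the cycle at v₀ and colour the path 0, 1, …, where 0 receives all of L(v₀).
-- For each vertex i there is a set P of colours such that every b-set B with |P ∩ B| ≤ m can be
-- used at i + 1 (as far as 0, …, i are concerned).  Here |P| = b and m = j e for i = 2j, and
-- |P| = b + e and m = (j + 1) e for i = 2j + 1.  After 2k vertices m = k e ≥ b, hence the condition
-- is void and the path can be closed up at v₀.
--
-- Necessity.  If the lists of successive vertices are P ∪ Q, Q ∪ R, … with cores of sizes b and
-- b + e alternating, the same count is forced: the b colours of a vertex overlap its incoming core in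
-- at most j e colours after 2j steps.  Closing up at v₀ forces b ≤ k e.

open import Defs
open import Data.Nat using (ℕ; zero; suc; _+_; _*_; _∸_; _⊓_; _≤_; _<_; z≤n; s≤s; NonZero; >-nonZero; _≟_; _≤?_)
open import Data.Nat.Properties
open import Data.Nat.DivMod using (_%_; _mod_; %-distribˡ-+; m%n%n≡m%n; m%n<n; m<n⇒m%n≡m; n%n≡0; m*n%n≡0; [m+n]%n≡m%n; m≡m%n+[m/n]*n; m≥n⇒m/n>0) renaming (_/_ to _/ℕ_)
open import Data.Nat.Tactic.RingSolver using (solve-∀)
import Data.Integer as ℤ
import Data.Integer.Properties as ℤ
open import Data.Rational using (ℚ; _/_; 1ℚ; toℚᵘ) renaming (_+_ to _+ℚ_; _≤_ to _≤ℚ_)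
import Data.Rational.Properties as ℚ
open import Data.Rational.Unnormalised as ℚᵘ using (mkℚᵘ; *≤*; *≡*)
import Data.Rational.Unnormalised.Properties as ℚᵘ
open import Data.Fin using (Fin; toℕ)
open import Data.Fin.Properties using (toℕ-fromℕ<; toℕ-injective; toℕ<n; toℕ≤n)
open import Data.List using (List; []; _∷_; _++_; length; filter; take; applyUpTo)
open import Data.List.Properties using (length-++; length-take; length-applyUpTo; take++drop≡id; filter-notAll)
open import Data.List.Membership.DecPropositional _≟_ using (_∈_; _∉_; _∈?_; _∉?_)
open import Data.List.Membership.Propositional.Properties using (∈-filter⁺; ∈-filter⁻; ∈-++⁺ˡ; ∈-++⁻; ∈-applyUpTo⁺; ∈-applyUpTo⁻)
open import Data.List.Relation.Unary.Any as Any using (here; there)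
open import Data.List.Relation.Unary.AllPairs using ([]; _∷_)
open import Data.List.Relation.Unary.Unique.Propositional using (Unique)
open import Data.List.Relation.Unary.Unique.Propositional.Properties as Unique using (Unique[x∷xs]⇒x∉xs)
open import Data.List.Relation.Binary.Subset.Propositional using (_⊆_)
open import Data.List.Relation.Binary.Disjoint.Propositional using (Disjoint)
open import Data.Product using (_×_; _,_; ∃; proj₁; proj₂; swap)
open import Data.Sum as Sum using (_⊎_; inj₁; inj₂; [_,_]′)
open import Function using (_∘_; id)
open import Relation.Nullary using (yes; no; contradiction)
open import Relation.Binary.PropositionalEquality using (_≡_; _≢_; refl; sym; trans; cong; cong₂; subst; subst₂; module ≡-Reasoning)

-- Finite sets as duplicate-free lists

infixl 7 _∩_ _∖_

_∩_ _∖_ : List ℕ → List ℕ → List ℕ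
S ∩ T = filter (_∈? T) S
S ∖ T = filter (_∉? T) S

∈-∩⁺ : ∀ {x S T} → x ∈ S → x ∈ T → x ∈ S ∩ T
∈-∩⁺ {T = T} = ∈-filter⁺ (_∈? T)

∈-∩⁻ : ∀ {x} S T → x ∈ S ∩ T → x ∈ S × x ∈ T
∈-∩⁻ S T = ∈-filter⁻ (_∈? T) {xs = S}

∈-∖⁺ : ∀ {x S T} → x ∈ S → x ∉ T → x ∈ S ∖ T
∈-∖⁺ {T = T} = ∈-filter⁺ (_∉? T)

∈-∖⁻ : ∀ {x} S T → x ∈ S ∖ T → x ∈ S × x ∉ T
∈-∖⁻ S T = ∈-filter⁻ (_∉? T) {xs = S}

∩-unique : ∀ {S} T → Unique S → Unique (S ∩ T)
∩-unique T = Unique.filter⁺ (_∈? T)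

∖-unique : ∀ {S} T → Unique S → Unique (S ∖ T)
∖-unique T = Unique.filter⁺ (_∉? T)

take-⊆ : ∀ m (S : List ℕ) → take m S ⊆ S
take-⊆ m S x∈ = subst (_ ∈_) (take++drop≡id m S) (∈-++⁺ˡ x∈)

length-∩+∖ : ∀ S T → length (S ∩ T) + length (S ∖ T) ≡ length S
length-∩+∖ []      T = refl
length-∩+∖ (x ∷ S) T with x ∈? T
... | yes _ = cong suc (length-∩+∖ S T)
... | no  _ = trans (+-suc _ _) (cong suc (length-∩+∖ S T))

-- Induction on `S`: its tail lies in `T` with the head removed, and that removal shortens `T`.
unique-⊆⇒length≤ : ∀ {S T} → Unique S → S ⊆ T → length S ≤ length T
unique-⊆⇒length≤ {[]}            _             _   = z≤n
unique-⊆⇒length≤ {x ∷ S} {T} xS!@(_ ∷ S!) S⊆T = ≤-trans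
  (s≤s (unique-⊆⇒length≤ S! λ y∈S → ∈-∖⁺ (S⊆T (there y∈S))
    λ { (here refl) → Unique[x∷xs]⇒x∉xs xS! y∈S }))
  (filter-notAll (_∉? (x ∷ [])) T (Any.map (λ x≡y y∉ → y∉ (here (sym x≡y))) (S⊆T (here refl))))

length-∩≤ : ∀ {S} T → Unique S → length (S ∩ T) ≤ length T
length-∩≤ {S} T S! = unique-⊆⇒length≤ (∩-unique T S!) (proj₂ ∘ ∈-∩⁻ S T)

length-∖≥ : ∀ {m S} T → Unique S → m + length T ≤ length S → m ≤ length (S ∖ T)
length-∖≥ {m} {S} T S! m+T≤S = +-cancelʳ-≤ (length T) m _ (begin
  m + length T                    ≤⟨ m+T≤S ⟩
  length S                        ≡⟨ length-∩+∖ S T ⟨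
  length (S ∩ T) + length (S ∖ T) ≤⟨ +-monoˡ-≤ _ (length-∩≤ T S!) ⟩
  length T + length (S ∖ T)       ≡⟨ +-comm (length T) _ ⟩
  length (S ∖ T) + length T       ∎)
  where open ≤-Reasoning

SubsetOf : List ℕ → ℕ → List ℕ → Set
SubsetOf S m C = Unique C × length C ≡ m × C ⊆ S

-- Take elements of P as long as possible, so that at most m come from outside.
choose : ∀ {m} S R P b → Unique S → Unique P → P ⊆ S →
  b + length R ≤ length S → b ≤ length (P ∖ R) + m →
  ∃ λ C → SubsetOf S b C × Disjoint C R × length (C ∖ P) ≤ m
choose {m} S R P b S! P! P⊆S b+R≤S b≤P∖R+m =
  C , (C! , C-length , proj₁ ∘ C⊆S∖R) , (λ (x∈C , x∈R) → proj₂ (C⊆S∖R x∈C) x∈R) , (begin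
    length (C ∖ P)                  ≤⟨ unique-⊆⇒length≤ (∖-unique P C!) C∖P⊆ ⟩
    length (take (b ∸ length X) Y)  ≡⟨ length-take (b ∸ length X) Y ⟩
    (b ∸ length X) ⊓ length Y       ≤⟨ m⊓n≤m _ _ ⟩
    b ∸ length X                    ≤⟨ m≤n+o⇒m∸n≤o b (length X) b≤P∖R+m ⟩
    m                               ∎)
  where
  open ≤-Reasoning
  X = P ∖ R
  Y = (S ∖ R) ∖ X
  X! : Unique X
  X! = ∖-unique R P!
  Y! : Unique Y
  Y! = ∖-unique X (∖-unique R S!)
  C = take b X ++ take (b ∸ length X) Y
  C! : Unique C
  C! = Unique.++⁺ (Unique.take⁺ b X!) (Unique.take⁺ (b ∸ length X) Y!)
    λ (x∈X , x∈Y) → proj₂ (∈-∖⁻ (S ∖ R) X (take-⊆ _ Y x∈Y)) (take-⊆ b X x∈X)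
  C⊆S∖R : ∀ {x} → x ∈ C → x ∈ S × x ∉ R
  C⊆S∖R x∈C with ∈-++⁻ (take b X) x∈C
  ... | inj₁ x∈X = let x∈P , x∉R = ∈-∖⁻ P R (take-⊆ b X x∈X) in P⊆S x∈P , x∉R
  ... | inj₂ x∈Y = ∈-∖⁻ S R (proj₁ (∈-∖⁻ (S ∖ R) X (take-⊆ _ Y x∈Y)))
  C∖P⊆ : C ∖ P ⊆ take (b ∸ length X) Y
  C∖P⊆ x∈ with ∈-∖⁻ C P x∈
  ... | x∈C , x∉P with ∈-++⁻ (take b X) x∈C
  ...   | inj₁ x∈X = contradiction (proj₁ (∈-∖⁻ P R (take-⊆ b X x∈X))) x∉P
  ...   | inj₂ x∈Y = x∈Y
  -- If `X` has at most b elements, enough colours remain because S without `R` has at least b.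
  -- Otherwise nothing from `Y` is wanted and the truncated difference is 0.
  Y-length : b ∸ length X ≤ length Y
  Y-length with length X ≤? b
  ... | yes X≤b = length-∖≥ X (∖-unique R S!)
    (subst (_≤ _) (sym (m∸n+n≡m X≤b)) (length-∖≥ R S! b+R≤S))
  ... | no X≰b = subst (_≤ length Y) (sym (m≤n⇒m∸n≡0 (≰⇒≥ X≰b))) z≤n
  C-length : length C ≡ b
  C-length = begin-equality
    length C                                               ≡⟨ length-++ (take b X) ⟩
    length (take b X) + length (take (b ∸ length X) Y)     ≡⟨ cong₂ _+_ (length-take b X) (length-take (b ∸ length X) Y) ⟩
    b ⊓ length X + (b ∸ length X) ⊓ length Y               ≡⟨ cong₂ _+_ (⊓-comm b (length X)) (m≤n⇒m⊓n≡m Y-length) ⟩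
    length X ⊓ b + (b ∸ length X)                          ≡⟨ m⊓n+n∸m≡n (length X) b ⟩
    b                                                      ∎

choose-avoiding : ∀ S R b → Unique S → b + length R ≤ length S →
  ∃ λ C → SubsetOf S b C × Disjoint C R
choose-avoiding S R b S! b+R≤S =
  -- No colours are preferred here: `P` is empty, and m = b makes the last bound vacuous.
  let C , C⊆S , C#R , _ = choose S R [] b S! [] (λ ()) b+R≤S ≤-refl in C , C⊆S , C#R

-- Colouring a path

module PathColoring (L : ℕ → List ℕ) (b : ℕ) where

  -- Path i C: a colouring of the path 0, …, i in which 0 gets all of L 0 and i gets C.
  data Path : ℕ → List ℕ → Set where
    start : Path 0 (L 0)
    step  : ∀ {i C C′} → Path i C → SubsetOf (L (suc i)) b C′ → Disjoint C C′ → Path (suc i) C′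

  -- core ∩ B measures how much B obstructs an extension: up to m common colours are tolerated.
  record Flexible (i s m : ℕ) : Set where
    field
      core        : List ℕ
      core-unique : Unique core
      core-length : length core ≡ s
      extend      : ∀ B → Unique B → length B ≡ b → length (core ∩ B) ≤ m →
                    ∃ λ C → Path i C × Disjoint C B

  -- The new core avoids the old one, and the colour set of the new vertex is drawn from the new
  -- core except for m colours, so it meets the old core in at most m colours.
  flexible-step : ∀ {i s m} s′ m′ → Flexible i s m → Unique (L (suc i)) →
    length (L (suc i)) ≡ s′ + s → b + b ≤ s′ + s → b + m′ ≤ s′ + m → Flexible (suc i) s′ m′
  flexible-step {i} {s} {m} s′ m′ F A! |A| 2b≤a b+m′≤s′+m
    with P′ , (P′! , |P′| , P′⊆A) , P′#P ← choose-avoiding (L (suc i)) (Flexible.core F) s′ A!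
           (≤-reflexive (trans (cong (s′ +_) (Flexible.core-length F)) (sym |A|)))
    = record { core = P′ ; core-unique = P′! ; core-length = |P′| ; extend = ext }
    where
    open Flexible F
    open ≤-Reasoning
    A = L (suc i)
    ext : ∀ B → Unique B → length B ≡ b → length (P′ ∩ B) ≤ m′ →
          ∃ λ C → Path (suc i) C × Disjoint C B
    ext B B! |B| P′∩B≤m′ =
      let C , C∈@(C! , |C| , _) , C#B , C∖P′≤m = choose A B P′ b A! P′! P′⊆A
            (subst₂ _≤_ (cong (b +_) (sym |B|)) (sym |A|) 2b≤a) b≤
          C₀ , p , C₀#C = extend C C! |C| (≤-trans (unique-⊆⇒length≤ (∩-unique C core-unique) core∩C⊆) C∖P′≤m)
      in C , step p C∈ C₀#C , C#B
      where
      core∩C⊆ : ∀ {C} → core ∩ C ⊆ C ∖ P′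
      core∩C⊆ {C} x∈ = let x∈P , x∈C = ∈-∩⁻ core C x∈ in ∈-∖⁺ x∈C λ x∈P′ → P′#P (x∈P′ , x∈P)
      -- At most m′ of the s′ colours of `P′` lie in `B`, so at least s′ - m′ survive, and s′ - m′ +
      -- m ≥ b by hypothesis. Adding m′ to both sides avoids the subtraction.
      b≤ : b ≤ length (P′ ∖ B) + m
      b≤ = +-cancelʳ-≤ m′ b _ (begin
        b + m′                              ≤⟨ b+m′≤s′+m ⟩
        s′ + m                              ≡⟨ cong (_+ m) (trans (sym |P′|) (sym (length-∩+∖ P′ B))) ⟩
        length (P′ ∩ B) + length (P′ ∖ B) + m ≤⟨ +-monoˡ-≤ m (+-monoˡ-≤ _ P′∩B≤m′) ⟩
        m′ + length (P′ ∖ B) + m            ≡⟨ rearrange m′ _ m ⟩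
        length (P′ ∖ B) + m + m′            ∎)
        where
        rearrange : ∀ x y z → x + y + z ≡ y + z + x
        rearrange = solve-∀

  module _ (e n : ℕ)
    (L! : ∀ i → Unique (L i))
    (|L₀| : length (L 0) ≡ b)
    (|L| : ∀ i → suc i < n → length (L (suc i)) ≡ e + b + b) where

    2b≤a : b + b ≤ e + b + b
    2b≤a = +-monoˡ-≤ b (m≤n+m b e)

    -- A list of size e + 2b splits exactly into an old and a new core, so the sizes b and e + b
    -- alternate. Entering a vertex raises the tolerance by s′ - b: by e at an odd vertex, by
    -- nothing at an even one.
    flexible-even : ∀ j → j * 2 < n → Flexible (j * 2) b (j * e)
    flexible-odd  : ∀ j → suc (j * 2) < n → Flexible (suc (j * 2)) (e + b) (suc j * e)

    -- Vertex 0 has no freedom: its core is its whole list, and the tolerance 0 says that `B` misses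
    -- it.
    flexible-even zero    _  = record
      { core        = L 0
      ; core-unique = L! 0
      ; core-length = |L₀|
      ; extend      = λ B _ _ L₀∩B≤0 → L 0 , start , λ (x∈L₀ , x∈B) →
          contradiction (≤-trans (nonempty (∈-∩⁺ x∈L₀ x∈B)) L₀∩B≤0) λ ()
      }
      where
      nonempty : ∀ {x : ℕ} {S} → x ∈ S → 1 ≤ length S
      nonempty (here _)  = s≤s z≤n
      nonempty (there _) = s≤s z≤n
    flexible-even (suc j) lt = flexible-step b (suc j * e) (flexible-odd j (<-trans (n<1+n _) lt)) (L! _)
      (trans (|L| _ lt) (rearrange b e)) (subst (b + b ≤_) (rearrange b e) 2b≤a) ≤-refl
      where
      rearrange : ∀ b e → e + b + b ≡ b + (e + b)
      rearrange = solve-∀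

    flexible-odd j lt = flexible-step (e + b) (suc j * e) (flexible-even j (<-trans (n<1+n _) lt)) (L! _)
      (|L| _ lt) 2b≤a (≤-reflexive (rearrange b e (j * e)))
      where
      rearrange : ∀ b e m → b + (e + m) ≡ e + b + m
      rearrange = solve-∀

    |C∩B|≤ : ∀ {C} B j → Unique C → length B ≡ b → b ≤ suc j * e → length (C ∩ B) ≤ suc j * e
    |C∩B|≤ B j C! |B| b≤je = ≤-trans (length-∩≤ B C!) (≤-trans (≤-reflexive |B|) b≤je)

    -- The tolerance has reached b, so the last vertex can be coloured against any b-set, in
    -- particular against `L 0`.
    closed-even : ∀ j → suc (j * 2) < n → b ≤ suc j * e →
      ∃ λ C → Path (suc (j * 2)) C × Disjoint C (L 0)
    closed-even j lt b≤je = extend (L 0) (L! 0) |L₀| (|C∩B|≤ (L 0) j core-unique |L₀| b≤je)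
      where open Flexible (flexible-odd j lt)

    -- The last vertex first picks any b-set `B` off `L 0`, possible since 2b ≤ a. Its predecessor,
    -- whose tolerance has reached b, is then coloured against `B`.
    closed-odd : ∀ j → suc (suc (j * 2)) < n → b ≤ suc j * e →
      ∃ λ C → Path (suc (suc (j * 2))) C × Disjoint C (L 0)
    closed-odd j lt b≤je =
      let B , B∈@(B! , |B| , _) , B#L₀ = choose-avoiding (L (suc (suc (j * 2)))) (L 0) b (L! _) room
          C , p , C#B = extend B B! |B| (|C∩B|≤ B j core-unique |B| b≤je)
      in B , step p B∈ C#B , B#L₀
      where
      open Flexible (flexible-odd j (<-trans (n<1+n _) lt))
      room : b + length (L 0) ≤ length (L (suc (suc (j * 2))))
      room rewrite |L₀| | |L| _ lt = 2b≤a

  -- A path unrolled into a function, so that colours can be looked up by position. Values beyond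
  -- `m` are unconstrained.
  record Coloring (m : ℕ) (C : List ℕ) : Set where
    field
      color    : ℕ → List ℕ
      first    : color 0 ≡ L 0
      last     : color m ≡ C
      proper   : ∀ i → i ≤ m → SubsetOf (L i) b (color i)
      disjoint : ∀ i → i < m → Disjoint (color i) (color (suc i))

  path⇒coloring : ∀ {m C} → Unique (L 0) → length (L 0) ≡ b → Path m C → Coloring m C
  path⇒coloring L₀! |L₀| start = record
    { color    = λ _ → L 0
    ; first    = refl
    ; last     = refl
    ; proper   = λ { zero _ → L₀! , |L₀| , id }
    ; disjoint = λ _ ()
    }
  path⇒coloring L₀! |L₀| (step {m} {C} {C′} p C′∈ C#C′) = record
    { color    = color′
    ; first    = trans (old z≤n) first
    ; last     = new (n<1+n m)
    ; proper   = proper′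
    ; disjoint = disjoint′
    }
    where
    open Coloring (path⇒coloring L₀! |L₀| p)
    color′ : ℕ → List ℕ
    color′ i with i ≤? m
    ... | yes _ = color i
    ... | no  _ = C′
    old : ∀ {i} → i ≤ m → color′ i ≡ color i
    old {i} i≤m with i ≤? m
    ... | yes _   = refl
    ... | no  i≰m = contradiction i≤m i≰m
    new : ∀ {i} → m < i → color′ i ≡ C′
    new {i} m<i with i ≤? m
    ... | yes i≤m = contradiction i≤m (<⇒≱ m<i)
    ... | no  _   = refl
    proper′ : ∀ i → i ≤ suc m → SubsetOf (L i) b (color′ i)
    proper′ i i≤1+m with m≤n⇒m<n∨m≡n i≤1+m
    ... | inj₁ (s≤s i≤m) rewrite old i≤m       = proper i i≤m
    ... | inj₂ refl      rewrite new (n<1+n m) = C′∈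
    disjoint′ : ∀ i → i < suc m → Disjoint (color′ i) (color′ (suc i))
    disjoint′ i (s≤s i≤m) with m≤n⇒m<n∨m≡n i≤m
    ... | inj₁ i<m  rewrite old i≤m | old i<m                  = disjoint i i<m
    ... | inj₂ refl rewrite old i≤m | new (n<1+n m) | last     = C#C′

-- Rotations of the cycle

[m%n+o]%n≡[m+o]%n : ∀ m o n .{{_ : NonZero n}} → (m % n + o) % n ≡ (m + o) % n
[m%n+o]%n≡[m+o]%n m o n = begin
  (m % n + o) % n           ≡⟨ %-distribˡ-+ (m % n) o n ⟩
  (m % n % n + o % n) % n   ≡⟨ cong (λ x → (x + o % n) % n) (m%n%n≡m%n m n) ⟩
  (m % n + o % n) % n       ≡⟨ %-distribˡ-+ m o n ⟨
  (m + o) % n               ∎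
  where open ≡-Reasoning

suc[m%n]%n≡suc[m]%n : ∀ m n .{{_ : NonZero n}} → suc (m % n) % n ≡ suc m % n
suc[m%n]%n≡suc[m]%n m n = begin
  suc (m % n) % n   ≡⟨ cong (_% n) (+-comm 1 (m % n)) ⟩
  (m % n + 1) % n   ≡⟨ [m%n+o]%n≡[m+o]%n m 1 n ⟩
  (m + 1) % n       ≡⟨ cong (_% n) (+-comm m 1) ⟩
  suc m % n         ∎
  where open ≡-Reasoning

toℕ-mod : ∀ m n .{{_ : NonZero n}} → toℕ (m mod n) ≡ m % n
toℕ-mod m n = toℕ-fromℕ< (m%n<n m n)

module Rotation (n : ℕ) .{{_ : NonZero n}} (v₀ : Fin n) where

  -- The summand `n ∸ toℕ v₀` stands for -v₀ modulo n, so `position` is the rotation that takes v₀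
  -- to 0, and `vertex` undoes it.
  position : Fin n → ℕ
  position v = (toℕ v + (n ∸ toℕ v₀)) % n

  vertex : ℕ → Fin n
  vertex i = (toℕ v₀ + i) mod n

  v₀+x+[n∸v₀] : ∀ x → (toℕ v₀ + x + (n ∸ toℕ v₀)) % n ≡ x % n
  v₀+x+[n∸v₀] x = begin
    (toℕ v₀ + x + (n ∸ toℕ v₀)) % n   ≡⟨ cong (λ y → (y + (n ∸ toℕ v₀)) % n) (+-comm (toℕ v₀) x) ⟩
    (x + toℕ v₀ + (n ∸ toℕ v₀)) % n   ≡⟨ cong (_% n) (+-assoc x (toℕ v₀) _) ⟩
    (x + (toℕ v₀ + (n ∸ toℕ v₀))) % n ≡⟨ cong (λ y → (x + y) % n) (m+[n∸m]≡n (toℕ≤n v₀)) ⟩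
    (x + n) % n                       ≡⟨ [m+n]%n≡m%n x n ⟩
    x % n                             ∎
    where open ≡-Reasoning

  position-vertex : ∀ i → position (vertex i) ≡ i % n
  position-vertex i = begin
    (toℕ (vertex i) + (n ∸ toℕ v₀)) % n      ≡⟨ cong (λ y → (y + (n ∸ toℕ v₀)) % n) (toℕ-mod _ n) ⟩
    ((toℕ v₀ + i) % n + (n ∸ toℕ v₀)) % n    ≡⟨ [m%n+o]%n≡[m+o]%n _ _ n ⟩
    (toℕ v₀ + i + (n ∸ toℕ v₀)) % n          ≡⟨ v₀+x+[n∸v₀] i ⟩
    i % n                                    ∎
    where open ≡-Reasoning

  vertex-position : ∀ v → vertex (position v) ≡ v
  vertex-position v = toℕ-injective (begin
    toℕ (vertex (position v))                      ≡⟨ toℕ-mod _ n ⟩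
    (toℕ v₀ + (toℕ v + (n ∸ toℕ v₀)) % n) % n      ≡⟨ cong (_% n) (+-comm (toℕ v₀) _) ⟩
    ((toℕ v + (n ∸ toℕ v₀)) % n + toℕ v₀) % n      ≡⟨ [m%n+o]%n≡[m+o]%n _ _ n ⟩
    (toℕ v + (n ∸ toℕ v₀) + toℕ v₀) % n            ≡⟨ cong (_% n) (rearrange (toℕ v) _ (toℕ v₀)) ⟩
    (toℕ v₀ + toℕ v + (n ∸ toℕ v₀)) % n            ≡⟨ v₀+x+[n∸v₀] (toℕ v) ⟩
    toℕ v % n                                      ≡⟨ m<n⇒m%n≡m (toℕ<n v) ⟩
    toℕ v                                          ∎)
    where
    open ≡-Reasoning
    rearrange : ∀ x y z → x + y + z ≡ z + x + y
    rearrange = solve-∀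

  position-v₀ : position v₀ ≡ 0
  position-v₀ = trans (cong (_% n) (m+[n∸m]≡n (toℕ≤n v₀))) (n%n≡0 n)

  vertex-0 : vertex 0 ≡ v₀
  vertex-0 = trans (cong vertex (sym position-v₀)) (vertex-position v₀)

  vertex-suc≢v₀ : ∀ i → suc i < n → vertex (suc i) ≢ v₀
  vertex-suc≢v₀ i lt eq = contradiction (begin
    suc i                     ≡⟨ m<n⇒m%n≡m lt ⟨
    suc i % n                 ≡⟨ position-vertex (suc i) ⟨
    position (vertex (suc i)) ≡⟨ cong position eq ⟩
    position v₀               ≡⟨ position-v₀ ⟩
    0                         ∎) λ ()
    where open ≡-Reasoning

  position-suc : ∀ v w → toℕ w ≡ suc (toℕ v) % n → position w ≡ suc (position v) % n
  position-suc v w eq = begin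
    (toℕ w + d) % n             ≡⟨ cong (λ y → (y + d) % n) eq ⟩
    (suc (toℕ v) % n + d) % n   ≡⟨ [m%n+o]%n≡[m+o]%n _ _ n ⟩
    suc (toℕ v + d) % n         ≡⟨ suc[m%n]%n≡suc[m]%n _ n ⟨
    suc (position v) % n        ∎
    where
    open ≡-Reasoning
    d = n ∸ toℕ v₀

-- Parity of the length, and closing a path into the cycle

data Parity (n k : ℕ) : Set where
  even : ∀ j → n ≡ suc j * 2 → k ≡ suc j → Parity n k
  odd  : ∀ j → n ≡ suc (suc j * 2) → k ≡ suc j → Parity n k

parity : ∀ n → 3 ≤ n → Parity n (n /ℕ 2)
parity n 3≤n = split (n % 2) (n /ℕ 2) (m%n<n n 2) (m≡m%n+[m/n]*n n 2)
  where
  split : ∀ r k → r < 2 → n ≡ r + k * 2 → Parity n k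
  split 0 zero    _ refl = contradiction 3≤n λ ()
  split 1 zero    _ refl = contradiction 3≤n λ { (s≤s ()) }
  split 0 (suc j) _ eq   = even j eq refl
  split 1 (suc j) _ eq   = odd j eq refl
  split (suc (suc _)) _ (s≤s (s≤s ())) _

module _ (n : ℕ) .{{_ : NonZero n}} (v₀ : Fin n) (L : Fin n → List ℕ) (b : ℕ)
  (L! : ∀ v → Unique (L v)) (|L₀| : length (L v₀) ≡ b) where

  open Rotation n v₀
  open PathColoring (L ∘ vertex) b

  -- After rotation every edge joins i to i + 1 modulo n: either an edge of the path or the single
  -- edge from n - 1 back to 0.
  close-cycle : ∀ {m C} → n ≡ suc m → Path m C → Disjoint C (L (vertex 0)) →
    ∃ λ c → IsColoring (Cycle n) L b c
  close-cycle {m} n≡1+m p C#L₀ = color ∘ position , proper′ , disjoint′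
    where
    open Coloring (path⇒coloring (L! _) (trans (cong (length ∘ L) vertex-0) |L₀|) p)
    proper′ : ∀ v → SubsetOf (L v) b (color (position v))
    proper′ v = subst (λ w → SubsetOf (L w) b (color (position v))) (vertex-position v)
      (proper (position v) (≤-pred (subst (position v <_) n≡1+m (m%n<n _ n))))
    suc-% : ∀ {i} → suc i ≡ n → suc i % n ≡ 0
    suc-% 1+i≡n = trans (cong (_% n) 1+i≡n) (n%n≡0 n)
    disjoint-suc : ∀ i → i < n → Disjoint (color i) (color (suc i % n))
    disjoint-suc i i<n with m≤n⇒m<n∨m≡n i<n
    ... | inj₁ 1+i<n = subst (Disjoint (color i) ∘ color) (sym (m<n⇒m%n≡m 1+i<n))
      (disjoint i (≤-pred (subst (suc i <_) n≡1+m 1+i<n)))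
    -- The wrap-around edge: position n - 1 carries `C` and position 0 carries `L (vertex 0)`.
    ... | inj₂ 1+i≡n = subst₂ Disjoint
      (sym (trans (cong color (suc-injective (trans 1+i≡n n≡1+m))) last))
      (sym (trans (cong color (suc-% 1+i≡n)) first)) C#L₀
    disjoint-position : ∀ v w → toℕ w ≡ suc (toℕ v) % n →
      Disjoint (color (position v)) (color (position w))
    disjoint-position v w eq = subst (Disjoint (color (position v)) ∘ color)
      (sym (position-suc v w eq)) (disjoint-suc (position v) (m%n<n _ n))
    disjoint′ : ∀ v w → Adj (Cycle n) v w → Disjoint (color (position v)) (color (position w))
    disjoint′ v w (inj₁ eq) = disjoint-position v w eq
    disjoint′ v w (inj₂ eq) = disjoint-position w v eq ∘ swap

cycle-choosable : ∀ n .{{_ : NonZero n}} → 3 ≤ n → ∀ e b → b ≤ n /ℕ 2 * e →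
  FreeChoosable (Cycle n) (e + b + b) b
cycle-choosable n 3≤n e b b≤ke v₀ L L! |L| |L₀| = by-parity (parity n 3≤n)
  where
  open Rotation n v₀
  open PathColoring (L ∘ vertex) b
  |L₀|′ : length (L (vertex 0)) ≡ b
  |L₀|′ = trans (cong (length ∘ L) vertex-0) |L₀|
  |L|′ : ∀ i → suc i < n → length (L (vertex (suc i))) ≡ e + b + b
  |L|′ i lt = |L| (vertex (suc i)) (vertex-suc≢v₀ i lt)
  by-parity : Parity n (n /ℕ 2) → ∃ λ c → IsColoring (Cycle n) L b c
  by-parity (even j n≡ k≡) =
    let _ , p , C#L₀ = closed-even e n (λ _ → L! _) |L₀|′ |L|′ j
          (≤-reflexive (sym n≡)) (subst (λ k → b ≤ k * e) k≡ b≤ke)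
    in close-cycle n v₀ L b L! |L₀| n≡ p C#L₀
  by-parity (odd j n≡ k≡) =
    let _ , p , C#L₀ = closed-odd e n (λ _ → L! _) |L₀|′ |L|′ j
          (≤-reflexive (sym n≡)) (subst (λ k → b ≤ k * e) k≡ b≤ke)
    in close-cycle n v₀ L b L! |L₀| n≡ p C#L₀

-- Counting inequalities and intervals for the lower bound

length-cover : ∀ S P Q → Unique S → (∀ {x} → x ∈ S → x ∈ P ⊎ x ∈ Q) →
  length S ≤ length (S ∩ P) + length (S ∩ Q)
length-cover S P Q S! S⊆ = begin
  length S                        ≡⟨ length-∩+∖ S P ⟨
  length (S ∩ P) + length (S ∖ P) ≤⟨ +-monoʳ-≤ (length (S ∩ P)) (unique-⊆⇒length≤ (∖-unique P S!) S∖P⊆) ⟩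
  length (S ∩ P) + length (S ∩ Q) ∎
  where
  open ≤-Reasoning
  S∖P⊆ : S ∖ P ⊆ S ∩ Q
  S∖P⊆ x∈ with ∈-∖⁻ S P x∈
  ... | x∈S , x∉P = ∈-∩⁺ x∈S ([ (λ x∈P → contradiction x∈P x∉P) , id ]′ (S⊆ x∈S))

-- The two intersections concatenate to a duplicate-free list inside `P`.
length-disjoint-∩ : ∀ {C C′} P → Unique C → Unique C′ → Disjoint C C′ →
  length (C ∩ P) + length (C′ ∩ P) ≤ length P
length-disjoint-∩ {C} {C′} P C! C′! C#C′ = subst (_≤ length P) (length-++ (C ∩ P))
  (unique-⊆⇒length≤
    (Unique.++⁺ (∩-unique P C!) (∩-unique P C′!)
      λ (x∈ , x∈′) → C#C′ (proj₁ (∈-∩⁻ C P x∈) , proj₁ (∈-∩⁻ C′ P x∈′)))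
    ([ proj₂ ∘ ∈-∩⁻ C P , proj₂ ∘ ∈-∩⁻ C′ P ]′ ∘ ∈-++⁻ (C ∩ P)))

interval : ℕ → ℕ → List ℕ
interval l s = applyUpTo (l +_) s

interval-unique : ∀ l s → Unique (interval l s)
interval-unique l s = Unique.applyUpTo⁺₁ (l +_) s λ i<j _ eq → <⇒≢ i<j (+-cancelˡ-≡ l _ _ eq)

interval-disjoint : ∀ {l s l′ s′} → l + s ≤ l′ → Disjoint (interval l s) (interval l′ s′)
interval-disjoint {l} {s} {l′} l+s≤l′ (x∈ , x∈′)
  with i , i<s , refl ← ∈-applyUpTo⁻ (l +_) x∈
  with j , _ , eq ← ∈-applyUpTo⁻ (l′ +_) x∈′
  = <⇒≱ (+-monoʳ-< l i<s) (≤-trans l+s≤l′ (subst (l′ ≤_) (sym eq) (m≤m+n l′ j)))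

interval-⊆ : ∀ {l s s′} → s ≤ s′ → interval l s ⊆ interval l s′
interval-⊆ {l} s≤s′ x∈ with i , i<s , refl ← ∈-applyUpTo⁻ (l +_) x∈ = ∈-applyUpTo⁺ (l +_) (<-≤-trans i<s s≤s′)

-- Lists without a colouring

-- A colouring of the cycle read periodically along the natural numbers. The field `allowed` stops
-- at n because the lists `L i` need not be periodic.
record ClosedWalk (n b : ℕ) (L : ℕ → List ℕ) : Set where
  field
    color    : ℕ → List ℕ
    unique   : ∀ i → Unique (color i)
    size     : ∀ i → length (color i) ≡ b
    allowed  : ∀ i → i < n → color i ⊆ L i
    disjoint : ∀ i → Disjoint (color i) (color (suc i))
    closed   : color n ≡ color 0

  -- color i and color (suc i) compete for the d + b colours of Q, and color i has few colours in P.
  transfer : ∀ {P Q} d i → length Q ≡ d + b → (∀ {x} → x ∈ color i → x ∈ P ⊎ x ∈ Q) →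
    length (color (suc i) ∩ Q) ≤ d + length (color i ∩ P)
  transfer {P} {Q} d i |Q| cover = +-cancelʳ-≤ b _ _ (begin
    x′ + b                                          ≡⟨ cong (x′ +_) (size i) ⟨
    x′ + length (color i)                           ≤⟨ +-monoʳ-≤ x′ (length-cover (color i) P Q (unique i) cover) ⟩
    x′ + (length (color i ∩ P) + y)                 ≡⟨ rearrange x′ _ y ⟩
    length (color i ∩ P) + (y + x′)                 ≤⟨ +-monoʳ-≤ (length (color i ∩ P)) (length-disjoint-∩ Q (unique i) (unique (suc i)) (disjoint i)) ⟩
    length (color i ∩ P) + length Q                 ≡⟨ cong (length (color i ∩ P) +_) |Q| ⟩
    length (color i ∩ P) + (d + b)                  ≡⟨ rearrange′ _ d b ⟩
    d + length (color i ∩ P) + b                    ∎)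
    where
    open ≤-Reasoning
    x′ = length (color (suc i) ∩ Q)
    y = length (color i ∩ Q)
    rearrange : ∀ x y z → x + (y + z) ≡ y + (z + x)
    rearrange = solve-∀
    rearrange′ : ∀ x y z → x + (y + z) ≡ y + x + z
    rearrange′ = solve-∀

  -- The case of empty `P`: `color 0` takes b of the d + b colours of `Q` and leaves d.
  transfer-start : ∀ {Q} d → length Q ≡ d + b → color 0 ⊆ Q → length (color 1 ∩ Q) ≤ d
  transfer-start {Q} d |Q| cover = subst (length (color 1 ∩ Q) ≤_) (+-identityʳ d)
    (≤-trans (transfer {[]} d 0 |Q| (inj₂ ∘ cover)) (+-monoʳ-≤ d (length-∩≤ [] (unique 0))))

  module _ {D T : List ℕ} {e i : ℕ} (|D| : length D ≡ b) (|T| : length T ≡ e + b)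
    (cover : ∀ j → i ≤ j → j < n → ∀ {x} → x ∈ color j → x ∈ D ⊎ x ∈ T) where

    -- Each round makes two transfers: from T to D without gain, as D has only b colours, then from
    -- D to T with gain e.
    drift : ∀ {m} j → j * 2 + i < n → length (color i ∩ T) ≤ m →
      length (color (j * 2 + i) ∩ T) ≤ j * e + m
    drift     zero    _  start≤m = start≤m
    drift {m} (suc j) lt start≤m = begin
      length (color (2 + k) ∩ T)     ≤⟨ transfer e (suc k) |T| (cover (suc k) (m≤n⇒m≤1+n i≤k) (<-trans (n<1+n _) lt)) ⟩
      e + length (color (1 + k) ∩ D) ≤⟨ +-monoʳ-≤ e (transfer 0 k |D| (Sum.swap ∘ cover k i≤k k<n)) ⟩
      e + length (color k ∩ T)       ≤⟨ +-monoʳ-≤ e (drift j k<n start≤m) ⟩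
      e + (j * e + m)                ≡⟨ +-assoc e (j * e) m ⟨
      suc j * e + m                  ∎
      where
      open ≤-Reasoning
      k = j * 2 + i
      i≤k = m≤n+m i (j * 2)
      k<n = <-trans (n<1+n _) (<-trans (n<1+n _) lt)

    -- Back at the start the walk has all b of its colours in D, while the drift and one last
    -- transfer from T to D bound that number.
    walk-bound : ∀ {m} j → n ≡ suc (j * 2 + i) → color 0 ⊆ D → length (color i ∩ T) ≤ m → b ≤ j * e + m
    walk-bound {m} j n≡ color₀⊆D start≤m = begin
      b                               ≡⟨ size 0 ⟨
      length (color 0)                ≤⟨ unique-⊆⇒length≤ (unique 0) (λ x∈ → ∈-∩⁺ x∈ (color₀⊆D x∈)) ⟩
      length (color 0 ∩ D)            ≡⟨ cong (λ C → length (C ∩ D)) closed ⟨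
      length (color n ∩ D)            ≡⟨ cong (λ k → length (color k ∩ D)) n≡ ⟩
      length (color (suc k) ∩ D)      ≤⟨ transfer 0 k |D| (Sum.swap ∘ cover k (m≤n+m i (j * 2)) k<n) ⟩
      length (color k ∩ T)            ≤⟨ drift j k<n start≤m ⟩
      j * e + m                       ∎
      where
      open ≤-Reasoning
      k = j * 2 + i
      k<n : k < n
      k<n = ≤-reflexive (sym n≡)

module _ {n a b : ℕ} .{{_ : NonZero n}} (choosable : FreeChoosable (Cycle n) a b) where

  -- The special vertex is taken to be 0, so that lists can be prescribed by position along the
  -- walk.
  closed-walk : ∀ L → (∀ i → Unique (L i)) → length (L 0) ≡ b → (∀ i → length (L (suc i)) ≡ a) →
    ClosedWalk n b L
  closed-walk L L! |L₀| |L| =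
    let c , proper , disj = choosable (0 mod n) (L ∘ toℕ) (λ v → L! (toℕ v)) |L|′ |L₀|′ in record
    { color    = λ i → c (i mod n)
    ; unique   = λ i → proj₁ (proper (i mod n))
    ; size     = λ i → proj₁ (proj₂ (proper (i mod n)))
    ; allowed  = λ i i<n → subst (λ k → c (i mod n) ⊆ L k) (trans (toℕ-mod i n) (m<n⇒m%n≡m i<n))
                   (proj₂ (proj₂ (proper (i mod n))))
    ; disjoint = λ i → disj (i mod n) (suc i mod n) (inj₁ (toℕ-suc-mod i))
    ; closed   = cong c (toℕ-injective (trans (toℕ-mod n n) (trans (n%n≡0 n) (sym toℕ-0-mod))))
    }
    where
    toℕ-0-mod : toℕ (0 mod n) ≡ 0
    toℕ-0-mod = trans (toℕ-mod 0 n) (m*n%n≡0 0 n)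
    |L₀|′ : length (L (toℕ (0 mod n))) ≡ b
    |L₀|′ = trans (cong (length ∘ L) toℕ-0-mod) |L₀|
    |L|′ : ∀ v → v ≢ 0 mod n → length (L (toℕ v)) ≡ a
    |L|′ v v≢0 with toℕ v in eq
    ... | zero  = contradiction (toℕ-injective (trans eq (sym toℕ-0-mod))) v≢0
    ... | suc i = |L| i
    toℕ-suc-mod : ∀ i → toℕ (suc i mod n) ≡ suc (toℕ (i mod n)) % n
    toℕ-suc-mod i = begin
      toℕ (suc i mod n)           ≡⟨ toℕ-mod (suc i) n ⟩
      suc i % n                   ≡⟨ suc[m%n]%n≡suc[m]%n i n ⟨
      suc (i % n) % n             ≡⟨ cong (λ r → suc r % n) (toℕ-mod i n) ⟨
      suc (toℕ (i mod n)) % n     ∎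
      where open ≡-Reasoning

  -- When all lists lie in one set of a colours, two adjacent vertices need 2b of them. This
  -- licenses writing a as e + 2b.
  choosable⇒2b≤a : 2 ≤ n → b + b ≤ a
  choosable⇒2b≤a 2≤n = begin
    b + b                                     ≡⟨ cong₂ _+_ (size 0) (size 1) ⟨
    length (color 0) + length (color 1)       ≤⟨ +-mono-≤ (inside 0 color₀⊆) (inside 1 color₁⊆) ⟩
    length (color 0 ∩ P) + length (color 1 ∩ P) ≤⟨ length-disjoint-∩ P (unique 0) (unique 1) (disjoint 0) ⟩
    length P                                  ≡⟨ length-applyUpTo (0 +_) a ⟩
    a                                         ∎
    where
    open ≤-Reasoning
    P = interval 0 a
    L : ℕ → List ℕ
    L zero    = interval 0 b
    L (suc _) = P
    L! : ∀ i → Unique (L i)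
    L! zero    = interval-unique 0 b
    L! (suc _) = interval-unique 0 a
    open ClosedWalk (closed-walk L L! (length-applyUpTo (0 +_) b) (λ _ → length-applyUpTo (0 +_) a))
    inside : ∀ i → color i ⊆ P → length (color i) ≤ length (color i ∩ P)
    inside i color⊆P = unique-⊆⇒length≤ (unique i) λ x∈ → ∈-∩⁺ x∈ (color⊆P x∈)
    color₁⊆ : color 1 ⊆ P
    color₁⊆ = allowed 1 2≤n
    -- Vertex 1 already forces b ≤ a, which is what places the shorter list of vertex 0 inside `P`.
    b≤a : b ≤ a
    b≤a = subst₂ _≤_ (size 1) (length-applyUpTo (0 +_) a) (unique-⊆⇒length≤ (unique 1) color₁⊆)
    color₀⊆ : color 0 ⊆ P
    color₀⊆ = interval-⊆ b≤a ∘ allowed 0 (<-trans (s≤s z≤n) 2≤n)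

module _ {n e b : ℕ} .{{_ : NonZero n}} (choosable : FreeChoosable (Cycle n) (e + b + b) b) where

  private
    -- [0,b), [b,2b+e), [2b+e,3b+e) and [b,b+e)
    D T D′ E : List ℕ
    D  = interval 0 b
    T  = interval b (e + b)
    D′ = interval (b + (e + b)) b
    E  = interval b e

    |D| : length D ≡ b
    |D| = length-applyUpTo _ b
    |T| : length T ≡ e + b
    |T| = length-applyUpTo _ (e + b)
    |D′| : length D′ ≡ b
    |D′| = length-applyUpTo _ b
    |D++E| : length (D ++ E) ≡ e + b
    |D++E| = trans (length-++ D) (trans (cong₂ _+_ |D| (length-applyUpTo _ e)) (+-comm b e))

    D++T-unique : Unique (D ++ T)
    D++T-unique = Unique.++⁺ (interval-unique 0 b) (interval-unique b (e + b)) (interval-disjoint ≤-refl)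

    |D++T| : length (D ++ T) ≡ e + b + b
    |D++T| = trans (length-++ D) (trans (cong₂ _+_ |D| |T|) (+-comm b (e + b)))

  -- Here `color 0` exhausts D, so `color 1` misses D and `color 2` has at most e colours in T. The
  -- remaining j rounds, from 2 to n - 1, add j e.
  odd-cycle-bound : ∀ j → n ≡ suc (suc j * 2) → b ≤ suc j * e
  odd-cycle-bound j n≡ = subst (b ≤_) (+-comm (j * e) e)
    (walk-bound |D| |T| cover j (trans n≡ (cong suc (+-comm 2 (j * 2)))) color₀⊆D start)
    where
    L : ℕ → List ℕ
    L zero    = D
    L (suc _) = D ++ T
    L! : ∀ i → Unique (L i)
    L! zero    = interval-unique 0 b
    L! (suc _) = D++T-unique
    open ClosedWalk (closed-walk choosable L L! |D| (λ _ → |D++T|))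
    below : ∀ {i} → i ≤ 2 → i < n
    below i≤2 = subst (_ <_) (sym n≡) (s≤s (≤-trans i≤2 (s≤s (s≤s z≤n))))
    color₀⊆D : color 0 ⊆ D
    color₀⊆D = allowed 0 (below z≤n)
    cover₊ : ∀ i → suc i < n → ∀ {x} → x ∈ color (suc i) → x ∈ D ⊎ x ∈ T
    cover₊ i lt x∈ = ∈-++⁻ D (allowed (suc i) lt x∈)
    cover : ∀ i → 2 ≤ i → i < n → ∀ {x} → x ∈ color i → x ∈ D ⊎ x ∈ T
    cover (suc i) _ = cover₊ i
    start : length (color 2 ∩ T) ≤ e
    start = subst (length (color 2 ∩ T) ≤_) (+-identityʳ e)
      (≤-trans (transfer e 1 |T| (cover₊ 0 (below (s≤s z≤n))))
               (+-monoʳ-≤ e (transfer-start 0 |D| color₀⊆D)))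

  -- The closing edge again has core D, of size b. As n - 1 is odd, alternating core sizes make the
  -- first core have size e + b, so D is enlarged there by `E`. Three transfers give 2e at vertex 3,
  -- and j rounds add j e.
  even-cycle-bound : ∀ j → n ≡ suc (suc j) * 2 → b ≤ suc (suc j) * e
  even-cycle-bound j n≡ = subst (b ≤_) (rearrange (j * e) e)
    (walk-bound |D| |T| cover j (trans n≡ (cong suc (+-comm 3 (j * 2)))) color₀⊆D start)
    where
    rearrange : ∀ x y → x + (y + y) ≡ y + (y + x)
    rearrange = solve-∀
    -- The cores are D ++ E ⊇ L 0, then D′, T, D, T, D, …; D′ links D ++ E to T, which share E.
    L : ℕ → List ℕ
    L 0 = D
    L 1 = D′ ++ (D ++ E)
    L 2 = T ++ D′
    L (suc (suc (suc _))) = D ++ T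
    D′#D++E : Disjoint D′ (D ++ E)
    D′#D++E (x∈D′ , x∈) with ∈-++⁻ D x∈
    ... | inj₁ x∈D = interval-disjoint {0} (m≤m+n b (e + b)) (x∈D , x∈D′)
    ... | inj₂ x∈E = interval-disjoint (+-monoʳ-≤ b (m≤m+n e b)) (x∈E , x∈D′)
    L! : ∀ i → Unique (L i)
    L! 0 = interval-unique 0 b
    L! 1 = Unique.++⁺ (interval-unique _ b)
      (Unique.++⁺ (interval-unique 0 b) (interval-unique b e) (interval-disjoint ≤-refl)) D′#D++E
    L! 2 = Unique.++⁺ (interval-unique b (e + b)) (interval-unique _ b) (interval-disjoint ≤-refl)
    L! (suc (suc (suc _))) = D++T-unique
    |L| : ∀ i → length (L (suc i)) ≡ e + b + b
    |L| 0 = trans (length-++ D′) (trans (cong₂ _+_ |D′| |D++E|) (+-comm b (e + b)))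
    |L| 1 = trans (length-++ T) (cong₂ _+_ |T| |D′|)
    |L| (suc (suc _)) = |D++T|
    open ClosedWalk (closed-walk choosable L L! |D| |L|)
    below : ∀ {i} → i ≤ 3 → i < n
    below i≤3 = subst (_ <_) (sym n≡) (s≤s (≤-trans i≤3 (s≤s (s≤s (s≤s z≤n)))))
    color₀⊆D : color 0 ⊆ D
    color₀⊆D = allowed 0 (below z≤n)
    cover : ∀ i → 3 ≤ i → i < n → ∀ {x} → x ∈ color i → x ∈ D ⊎ x ∈ T
    cover (suc (suc (suc i))) _ lt x∈ = ∈-++⁻ D (allowed (suc (suc (suc i))) lt x∈)
    cover 1 (s≤s ())
    cover 2 (s≤s (s≤s ()))
    start : length (color 3 ∩ T) ≤ e + e
    start = begin
      length (color 3 ∩ T)            ≤⟨ transfer e 2 |T| (Sum.swap ∘ ∈-++⁻ T ∘ allowed 2 (below (s≤s (s≤s z≤n)))) ⟩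
      e + length (color 2 ∩ D′)       ≤⟨ +-monoʳ-≤ e (transfer 0 1 |D′| (Sum.swap ∘ ∈-++⁻ D′ ∘ allowed 1 (below (s≤s z≤n)))) ⟩
      e + length (color 1 ∩ (D ++ E)) ≤⟨ +-monoʳ-≤ e (transfer-start e |D++E| (∈-++⁺ˡ ∘ color₀⊆D)) ⟩
      e + e                           ∎
      where open ≤-Reasoning

  choosable⇒b≤ke : 3 ≤ n → b ≤ n /ℕ 2 * e
  choosable⇒b≤ke 3≤n with parity n 3≤n
  ... | odd j n≡ k≡          = subst (λ k → b ≤ k * e) (sym k≡) (odd-cycle-bound j n≡)
  ... | even (suc j) n≡ k≡   = subst (λ k → b ≤ k * e) (sym k≡) (even-cycle-bound j n≡)
  ... | even zero refl _     = contradiction 3≤n λ { (s≤s (s≤s ())) }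

-- Ratios

open import Data.Integer using (+_; +≤+)

-- Normalisation in `_/_` hides the given numerators and denominators, so the cross products are
-- compared among unnormalised rationals.
/-mono-≤ : ∀ a b c d .{{_ : NonZero b}} .{{_ : NonZero d}} → a * d ≤ c * b → + a / b ≤ℚ + c / d
/-mono-≤ a (suc b) c (suc d) ad≤cb = ℚ.toℚᵘ-cancel-≤
  (ℚᵘ.≤-respˡ-≃ (ℚᵘ.≃-sym (ℚ.toℚᵘ-fromℚᵘ (mkℚᵘ (+ a) b)))
    (ℚᵘ.≤-respʳ-≃ (ℚᵘ.≃-sym (ℚ.toℚᵘ-fromℚᵘ (mkℚᵘ (+ c) d)))
      (*≤* (subst₂ ℤ._≤_ (ℤ.pos-* a (suc d)) (ℤ.pos-* c (suc b)) (+≤+ ad≤cb)))))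

/-cancel-≤ : ∀ a b c d .{{_ : NonZero b}} .{{_ : NonZero d}} → + a / b ≤ℚ + c / d → a * d ≤ c * b
/-cancel-≤ a (suc b) c (suc d) a/b≤c/d
  with *≤* le ← ℚᵘ.≤-respˡ-≃ (ℚ.toℚᵘ-fromℚᵘ (mkℚᵘ (+ a) b))
       (ℚᵘ.≤-respʳ-≃ (ℚ.toℚᵘ-fromℚᵘ (mkℚᵘ (+ c) d)) (ℚ.toℚᵘ-mono-≤ a/b≤c/d))
  = ℤ.drop‿+≤+ (subst₂ ℤ._≤_ (sym (ℤ.pos-* a (suc d))) (sym (ℤ.pos-* c (suc b))) le)

2+1/k : ∀ k .{{_ : NonZero k}} → (1ℚ +ℚ 1ℚ) +ℚ (+ 1 / k) ≡ + (2 * k + 1) / k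
2+1/k (suc k) = ℚ.toℚᵘ-injective (begin
  toℚᵘ ((1ℚ +ℚ 1ℚ) +ℚ (+ 1 / suc k))          ≈⟨ ℚ.toℚᵘ-homo-+ (1ℚ +ℚ 1ℚ) (+ 1 / suc k) ⟩
  toℚᵘ (1ℚ +ℚ 1ℚ) ℚᵘ.+ toℚᵘ (+ 1 / suc k)     ≈⟨ ℚᵘ.+-congʳ (mkℚᵘ (+ 2) 0) (ℚ.toℚᵘ-fromℚᵘ (mkℚᵘ (+ 1) k)) ⟩
  mkℚᵘ (+ 2) 0 ℚᵘ.+ mkℚᵘ (+ 1) k              ≈⟨ *≡* (cong +_ (numerators k)) ⟩
  mkℚᵘ (+ (2 * suc k + 1)) k                  ≈⟨ ℚ.toℚᵘ-fromℚᵘ (mkℚᵘ (+ (2 * suc k + 1)) k) ⟨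
  toℚᵘ (+ (2 * suc k + 1) / suc k)            ∎)
  where
  open ℚᵘ.≃-Reasoning
  -- The numerators agree. The denominators differ only in form: the product 1 · (k + 1) computes to
  -- `suc (k + 0)`.
  numerators : ∀ k → (2 * suc k + 1) * suc k ≡ (2 * suc k + 1) * suc (k + 0)
  numerators k = cong (λ m → (2 * suc k + 1) * suc m) (sym (+-identityʳ k))

-- The slack e = a − 2b turns the ratio condition into b ≤ k e.
slack : ∀ k a b .{{_ : NonZero k}} → (2 * k + 1) * b ≤ a * k → ∃ λ e → a ≡ e + b + b × b ≤ k * e
slack k a b le = a ∸ (b + b) , a≡ , +-cancelʳ-≤ ((b + b) * k) b _ (begin
  b + (b + b) * k               ≡⟨ expand k b ⟨
  (2 * k + 1) * b               ≤⟨ le ⟩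
  a * k                         ≡⟨ cong (_* k) a≡ ⟩
  (e + b + b) * k               ≡⟨ expand′ k e b ⟩
  k * e + (b + b) * k           ∎)
  where
  open ≤-Reasoning
  e = a ∸ (b + b)
  expand : ∀ k b → (2 * k + 1) * b ≡ b + (b + b) * k
  expand = solve-∀
  expand′ : ∀ k e b → (e + b + b) * k ≡ k * e + (b + b) * k
  expand′ = solve-∀
  -- Drop the summand b from b + 2bk ≤ ak and cancel k.
  2b≤a : b + b ≤ a
  2b≤a = *-cancelʳ-≤ (b + b) a k (≤-trans (m≤n+m _ b) (subst (_≤ a * k) (expand k b) le))
  a≡ : a ≡ e + b + b
  a≡ = sym (trans (+-assoc e b b) (m∸n+n≡m 2b≤a))

slack⁻¹ : ∀ k e b → b ≤ k * e → (2 * k + 1) * b ≤ (e + b + b) * k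
slack⁻¹ k e b b≤ke = subst₂ _≤_ (expand k b) (expand′ k e b) (+-monoˡ-≤ ((b + b) * k) b≤ke)
  where
  expand : ∀ k b → b + (b + b) * k ≡ (2 * k + 1) * b
  expand = solve-∀
  expand′ : ∀ k e b → k * e + (b + b) * k ≡ (e + b + b) * k
  expand′ = solve-∀

choosable⇒ratio : ∀ n .{{_ : NonZero n}} → 3 ≤ n → ∀ a b → FreeChoosable (Cycle n) a b →
  (2 * (n /ℕ 2) + 1) * b ≤ a * (n /ℕ 2)
choosable⇒ratio n 3≤n a b choosable = subst (λ a → (2 * (n /ℕ 2) + 1) * b ≤ a * (n /ℕ 2)) (sym a≡)
  (slack⁻¹ (n /ℕ 2) e b (choosable⇒b≤ke (subst (λ a → FreeChoosable (Cycle n) a b) a≡ choosable) 3≤n))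
  where
  e = a ∸ (b + b)
  a≡ : a ≡ e + b + b
  a≡ = sym (trans (+-assoc e b b) (m∸n+n≡m (choosable⇒2b≤a choosable (<⇒≤ 3≤n))))

ratio⇒choosable : ∀ n .{{_ : NonZero n}} → 3 ≤ n → ∀ a b .{{_ : NonZero (n /ℕ 2)}} →
  (2 * (n /ℕ 2) + 1) * b ≤ a * (n /ℕ 2) → FreeChoosable (Cycle n) a b
ratio⇒choosable n 3≤n a b le with slack (n /ℕ 2) a b le
... | e , refl , b≤ke = cycle-choosable n 3≤n e b b≤ke

theorem3 : (n : ℕ) → (h : 3 ≤ n) →
    ((a b : ℕ) → 1 ≤ a → (nz : NonZero b) →
    ((1ℚ +ℚ 1ℚ) +ℚ invFloorHalf n h) ≤ℚ (+ a / b) {{nz}} →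
    FreeChoosable (Cycle n {{nonZero3 n h}}) a b)
    × FChrEq (Cycle n {{nonZero3 n h}}) ((1ℚ +ℚ 1ℚ) +ℚ invFloorHalf n h)
theorem3 n h = choosable , lower , greatest
  where
  k = n /ℕ 2
  instance
    n≢0 : NonZero n
    n≢0 = nonZero3 n h
    k≢0 : NonZero k
    k≢0 = >-nonZero (m≥n⇒m/n>0 {n} {2} (<⇒≤ h))
  r = (1ℚ +ℚ 1ℚ) +ℚ invFloorHalf n h
  choosable : ∀ a b → 1 ≤ a → (nz : NonZero b) → r ≤ℚ (+ a / b) {{nz}} → FreeChoosable (Cycle n) a b
  choosable a b _ nz r≤a/b = ratio⇒choosable n h a b
    (/-cancel-≤ (2 * k + 1) k a b {{k≢0}} {{nz}} (subst (_≤ℚ (+ a / b) {{nz}}) (2+1/k k) r≤a/b))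
  lower : ∀ q → FreeChoiceRatios (Cycle n) q → r ≤ℚ q
  lower _ (a , b , nz , _ , ch , refl) = subst (_≤ℚ (+ a / b) {{nz}}) (sym (2+1/k k))
    (/-mono-≤ (2 * k + 1) k a b {{k≢0}} {{nz}} (choosable⇒ratio n h a b ch))
  greatest : ∀ l → (∀ q → FreeChoiceRatios (Cycle n) q → l ≤ℚ q) → l ≤ℚ r
  -- The infimum is attained: a = 2k + 1 and b = k satisfy the ratio condition with equality.
  greatest l l≤ = l≤ r (2 * k + 1 , k , k≢0 , m≤n+m 1 (2 * k) , ratio⇒choosable n h _ k ≤-refl , 2+1/k k)
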